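{- Let $n\ge 2$, let $a_1,\ldots,a_n$ be positive integers with $\gcd(a_1,a_2)=1$, and let $S=\langle a_1,\ldots,a_n\rangle$ and $Q=\langle a_1,a_2\rangle$. If $a_i+a_j\in Q$ for all $i,j\in\{3,\ldots,n\}$ (including $i=j$), then the type of $S$ satisfies $t(S)\le n-1$.
   Context: For positive integers $a_1,\ldots,a_n$ with $\gcd(a_1,\ldots,a_n)=1$, $\langle a_1,\ldots,a_n\rangle=\{\sum_{i=1}^n\lambda_i a_i : \lambda_i\in\mathbb{Z},\ \lambda_i\ge 0\}$ is the numerical semigroup generated by $a_1,\ldots,a_n$. For a numerical semigroup $S$, the set of pseudo-Frobenius numbers is $T(S)=\{x\in\mathbb{N} : x\notin S,\ x+s\in S \text{ for all } s\in S \text{ with } s>0\}$ (with $\mathbb{N}$ the non-negative integers), and the type of $S$ is $t(S)=|T(S)|$. -}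

module Defs where

open import Level using (Level; 0ℓ)
open import Data.Nat using (ℕ; _+_; _*_; _<_)
open import Data.Nat.Properties using (+-0-commutativeMonoid)
open import Data.List using (List; length)
open import Data.List.Membership.Propositional using (_∈_)
open import Data.List.Relation.Unary.Unique.Propositional using (Unique)
open import Data.Product using (_×_; Σ-syntax)
open import Data.Vec.Functional using (Vector)
open import Function.Bundles using (_⇔_)
open import Relation.Binary.PropositionalEquality using (_≡_)
open import Relation.Nullary using (¬_)
open import Relation.Unary using (Pred)
open import Algebra.Properties.CommutativeMonoid.Sum +-0-commutativeMonoid using (sum)

private
  variable
    ℓ : Level

⟨_⟩ : ∀ {n} → Vector ℕ n → Pred ℕ 0ℓ
⟨_⟩ {n} a x = Σ[ c ∈ Vector ℕ n ] x ≡ sum (λ i → c i * a i)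

PseudoFrobenius : Pred ℕ ℓ → Pred ℕ ℓ
PseudoFrobenius S x = ¬ S x × (∀ s → S s → 0 < s → S (x + s))

-- Cardinality counts the numbers satisfying P, not the inhabitants of Σ ℕ P,
-- since P x need not be a proposition: a duplicate-free list of length k
-- whose elements are exactly the x with P x.
HasCardinality : Pred ℕ ℓ → ℕ → Set ℓ
HasCardinality P k =
  Σ[ xs ∈ List ℕ ] Unique xs × (∀ x → x ∈ xs ⇔ P x) × length xs ≡ k

-- The type t(S) as a relation: t(S) exists and equals k.
HasType : Pred ℕ ℓ → ℕ → Set ℓ
HasType S k = HasCardinality (PseudoFrobenius S) k

-- By hypothesis S is the union of the translates g + Q with g ∈ {0, a₃, …, aₙ}.
-- If x is pseudo-Frobenius then x + a₁ = g + p a₁ + q a₂ for such a g, and p = 0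
-- because x ∉ S.  So x lies on the progression g − a₁ + ℕ a₂, and each of these
-- n − 1 progressions contains at most one pseudo-Frobenius number, since x ∈ T(S)
-- forces x + k a₂ ∈ S for all k > 0.
module Submission where

open import Defs
open import Data.Nat using (ℕ; zero; suc; _+_; _*_; _∸_; _≤_; _<_; z≤n; s≤s; _≤?_; _<?_; NonZero; >-nonZero)
open import Data.Nat.Properties
open import Data.Nat.DivMod using (_/_; _%_; m≡m%n+[m/n]*n; m%n≤n; m*n/n≡m; /-monoˡ-≤)
open import Data.Nat.GCD using (gcd; gcd-GCD; GCD; module Bézout)
open import Data.Nat.Tactic.RingSolver using (solve-∀)
open import Data.Fin using (Fin; zero; suc; toℕ)
open import Data.Fin.Properties using (injective⇒≤)
open import Data.List using (List; length; lookup; filter; upTo)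
open import Data.List.Membership.Propositional using (_∈_)
open import Data.List.Membership.Propositional.Properties using (∈-lookup; ∈-filter⁺; ∈-filter⁻; ∈-upTo⁺)
import Data.List.Relation.Unary.All as All
import Data.List.Relation.Unary.AllPairs as AllPairs
open import Data.List.Relation.Unary.Unique.Propositional using (Unique)
open import Data.List.Relation.Unary.Unique.Propositional.Properties using (filter⁺; upTo⁺)
open import Data.Product using (_×_; Σ-syntax; ∃-syntax; _,_; proj₁; proj₂)
open import Data.Vec.Functional using (Vector; _∷_; []; tail)
open import Function using (_∘_)
open import Function.Bundles using (mk⇔)
open import Level using (Level)
open import Relation.Binary.Definitions using (tri<; tri≈; tri>)
open import Relation.Binary.PropositionalEquality using (_≡_; refl; sym; trans; cong; subst; module ≡-Reasoning)
open import Relation.Nullary using (yes; no; contradiction)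
open import Relation.Nullary.Decidable using (map′; ¬?; _×-dec_; _→-dec_)
open import Relation.Unary using (Pred; Decidable)

private
  variable
    ℓ : Level
    n : ℕ

0∈⟨_⟩ : (a : Vector ℕ n) → ⟨ a ⟩ 0
0∈⟨_⟩ {zero}  a = [] , refl
0∈⟨_⟩ {suc n} a with c , eq ← 0∈⟨ tail a ⟩ = 0 ∷ c , eq

⟨⟩-step : (a : Vector ℕ n) → ∀ i {x} → ⟨ a ⟩ x → ⟨ a ⟩ (a i + x)
⟨⟩-step a zero    (c , refl) = suc (c zero) ∷ tail c , sym (+-assoc (a zero) _ _)
⟨⟩-step a (suc i) (c , refl) with d , eq ← ⟨⟩-step (tail a) i (tail c , refl) =
  c zero ∷ d , trans (swap (a (suc i)) (c zero * a zero) _) (cong (c zero * a zero +_) eq)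
  where
  swap : ∀ x y z → x + (y + z) ≡ y + (x + z)
  swap = solve-∀

⟨⟩-steps : (a : Vector ℕ n) → ∀ i k {x} → ⟨ a ⟩ x → ⟨ a ⟩ (k * a i + x)
⟨⟩-steps a i zero    s = s
⟨⟩-steps a i (suc k) s =
  subst ⟨ a ⟩ (sym (+-assoc (a i) _ _)) (⟨⟩-step a i (⟨⟩-steps a i k s))

⟨⟩-multiple : (a : Vector ℕ n) → ∀ i k → ⟨ a ⟩ (k * a i)
⟨⟩-multiple a i k = subst ⟨ a ⟩ (+-identityʳ _) (⟨⟩-steps a i k 0∈⟨ a ⟩)

-- Coefficient vectors unfold into repeated addition of single generators, so closure of `P` only
-- has to be checked for one generator at a time.
⟨⟩-elim : (a : Vector ℕ n) (P : Pred ℕ ℓ) → P 0 → (∀ i {x} → P x → P (a i + x)) →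
          ∀ {x} → ⟨ a ⟩ x → P x
⟨⟩-elim {zero}  a P P0 P+ (c , refl) = P0
⟨⟩-elim {suc n} a P P0 P+ (c , refl) = steps (c zero) (⟨⟩-elim (tail a) P P0 (P+ ∘ suc) (tail c , refl))
  where
  steps : ∀ k {x} → P x → P (k * a zero + x)
  steps zero    p = p
  steps (suc k) p = subst P (sym (+-assoc (a zero) _ _)) (P+ zero (steps k p))

-- Search for the first coefficient `k`, then recurse on the remainder. Since `a zero` is positive,
-- `k ≤ k * a zero ≤ x`, so trying every `k < suc x` is exhaustive.
⟨⟩? : (a : Vector ℕ n) → (∀ i → 0 < a i) → Decidable ⟨ a ⟩
⟨⟩? {zero}  a pos zero    = yes ([] , refl)
⟨⟩? {zero}  a pos (suc x) = no λ ()
⟨⟩? {suc n} a pos x = map′ to from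
  (anyUpTo? (λ k → (k * a zero ≤? x) ×-dec ⟨⟩? (tail a) (pos ∘ suc) (x ∸ k * a zero)) (suc x))
  where
  to : ∃[ k ] k < suc x × k * a zero ≤ x × ⟨ tail a ⟩ (x ∸ k * a zero) → ⟨ a ⟩ x
  to (k , _ , ka≤x , c , eq) =
    k ∷ c , trans (sym (m+[n∸m]≡n ka≤x)) (cong (k * a zero +_) eq)
  from : ⟨ a ⟩ x → ∃[ k ] k < suc x × k * a zero ≤ x × ⟨ tail a ⟩ (x ∸ k * a zero)
  from (c , refl) =
    c zero , s≤s (≤-trans (m≤m*n (c zero) (a zero) {{>-nonZero (pos zero)}}) (m≤m+n _ _)) ,
    m≤m+n _ _ , tail c , m+n∸m≡n (c zero * a zero) _

-- With 1 + v b = u a, a number r + (r v + k) b equals r u a + k b; the quotient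
-- of z by b is at least r v as soon as z ≥ (b v) b.
bézout⇒cofinite : ∀ a b u v → 0 < b → 1 + v * b ≡ u * a →
                  ∀ z → b * v * b ≤ z → ∃[ p ] ∃[ q ] z ≡ p * a + q * b
bézout⇒cofinite a b u v b>0 eq z N≤z = r * u , k , (begin
  z                             ≡⟨ m≡m%n+[m/n]*n z b ⟩
  r + z / b * b                 ≡⟨ cong (λ h → r + h * b) (m+[n∸m]≡n rv≤z/b) ⟨
  r + (r * v + k) * b           ≡⟨ regroup r v k b ⟩
  r * (1 + v * b) + k * b       ≡⟨ cong (λ h → r * h + k * b) eq ⟩
  r * (u * a) + k * b           ≡⟨ cong (_+ k * b) (*-assoc r u a) ⟨
  r * u * a + k * b             ∎)
  where
  open ≡-Reasoning
  instance
    b≢0 : NonZero b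
    b≢0 = >-nonZero b>0
  r = z % b
  k = z / b ∸ r * v
  rv≤z/b : r * v ≤ z / b
  rv≤z/b = ≤-trans (*-monoˡ-≤ v (m%n≤n z b))
    (subst (_≤ z / b) (m*n/n≡m (b * v) b) (/-monoˡ-≤ b N≤z))
  regroup : ∀ r v k b → r + (r * v + k) * b ≡ r * (1 + v * b) + k * b
  regroup = solve-∀

-- Over ℕ, Bézout's identity leaves the surplus 1 on one side or the other. The second case is the
-- first with `a` and `b` exchanged, so its coefficients are swapped back at the end.
coprime⇒cofinite : ∀ a b → 0 < a → 0 < b → gcd a b ≡ 1 →
                   ∃[ N ] ∀ z → N ≤ z → ∃[ p ] ∃[ q ] z ≡ p * a + q * b
coprime⇒cofinite a b a>0 b>0 gcd≡1
  with Bézout.identity (subst (GCD a b) gcd≡1 (gcd-GCD a b))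
... | Bézout.+- u v eq = b * v * b , bézout⇒cofinite a b u v b>0 eq
... | Bézout.-+ u v eq = a * u * a , λ z N≤z →
  let p , q , z≡ = bézout⇒cofinite b a v u a>0 eq z N≤z
  in q , p , trans z≡ (+-comm (p * b) (q * a))

-- The quantifier over all `s` becomes finite: once `s ≥ N`, also `x + s ≥ N`, hence `x + s` is in
-- `S` by cofiniteness.
pseudoFrobenius? : {S : Pred ℕ ℓ} → Decidable S → ∀ N → (∀ z → N ≤ z → S z) →
                   Decidable (PseudoFrobenius S)
pseudoFrobenius? {S = S} S? N cofinite x = ¬? (S? x) ×-dec
  map′ extend (λ h {s} _ → h s) (allUpTo? (λ s → S? s →-dec (0 <? s →-dec S? (x + s))) N)
  where
  extend : (∀ {s} → s < N → S s → 0 < s → S (x + s)) → ∀ s → S s → 0 < s → S (x + s)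
  extend h s Ss s>0 with s <? N
  ... | yes s<N = h s<N Ss s>0
  ... | no  s≮N = cofinite (x + s) (≤-trans (≮⇒≥ s≮N) (m≤n+m s x))

lookup-injective : ∀ {A : Set ℓ} {xs : List A} → Unique xs →
                   ∀ {i j} → lookup xs i ≡ lookup xs j → i ≡ j
lookup-injective (_ AllPairs.∷ _) {zero}  {zero}  _  = refl
lookup-injective (x∉ AllPairs.∷ _) {zero}  {suc j} eq = contradiction eq (All.lookup x∉ (∈-lookup j))
lookup-injective (x∉ AllPairs.∷ _) {suc i} {zero}  eq = contradiction (sym eq) (All.lookup x∉ (∈-lookup i))
lookup-injective (_ AllPairs.∷ u) {suc i} {suc j} eq = cong suc (lookup-injective u eq)

-- Pigeonhole principle: without duplicates, positions inject into labels. The label `f` may depend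
-- on the membership proof, because it need only exist for members of the list.
unique⇒length≤ : ∀ {A : Set ℓ} {xs : List A} {k} → Unique xs → (f : ∀ {x} → x ∈ xs → Fin k) →
                 (∀ {x y} (x∈ : x ∈ xs) (y∈ : y ∈ xs) → f x∈ ≡ f y∈ → x ≡ y) →
                 length xs ≤ k
unique⇒length≤ u f f-inj = injective⇒≤ {f = λ i → f (∈-lookup i)}
  (λ {i} {j} eq → lookup-injective u (f-inj (∈-lookup i) (∈-lookup j) eq))

module _ {m : ℕ} (a : Vector ℕ (2 + m)) where

  private
    a₁ = a zero
    a₂ = a (suc zero)
    S = ⟨ a ⟩

  -- The generators 0, a₃, …, aₙ of S as a Q-module.
  moduleGenerators : Vector ℕ (1 + m)
  moduleGenerators = 0 ∷ tail (tail a)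

  QSpan : Pred ℕ _
  QSpan x = ∃[ j ] ∃[ p ] ∃[ q ] x ≡ moduleGenerators j + (p * a₁ + q * a₂)

  generator∈ : ∀ j → S (moduleGenerators j)
  generator∈ zero    = 0∈⟨ a ⟩
  generator∈ (suc i) = subst S (+-identityʳ _) (⟨⟩-step a (suc (suc i)) 0∈⟨ a ⟩)

  QSpan⊆⟨⟩ : ∀ {x} → QSpan x → S x
  QSpan⊆⟨⟩ (j , p , q , refl) =
    subst S (rotate (p * a₁) (q * a₂) (moduleGenerators j))
      (⟨⟩-steps a zero p (⟨⟩-steps a (suc zero) q (generator∈ j)))
    where
    rotate : ∀ x y z → x + (y + z) ≡ z + (x + y)
    rotate = solve-∀

  -- The union of translates contains 0 and is closed under adding any generator: `a₁` and `a₂`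
  -- raise a coefficient, and every other generator changes the translate.
  ⟨⟩⊆QSpan : (∀ i j → 2 ≤ toℕ i → 2 ≤ toℕ j → ⟨ a₁ ∷ a₂ ∷ [] ⟩ (a i + a j)) →
              ∀ {x} → S x → QSpan x
  ⟨⟩⊆QSpan sums∈Q = ⟨⟩-elim a QSpan (zero , 0 , 0 , refl) step
    where
    step : ∀ i {x} → QSpan x → QSpan (a i + x)
    step zero (j , p , q , refl) =
      j , suc p , q , shift a₁ (moduleGenerators j) (p * a₁) (q * a₂)
      where
      shift : ∀ w x y z → w + (x + (y + z)) ≡ x + (w + y + z)
      shift = solve-∀
    step (suc zero) (j , p , q , refl) =
      j , p , suc q , shift a₂ (moduleGenerators j) (p * a₁) (q * a₂)
      where
      shift : ∀ w x y z → w + (x + (y + z)) ≡ x + (y + (w + z))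
      shift = solve-∀
    step (suc (suc i)) (zero , p , q , refl) = suc i , p , q , refl
    -- Two generators beyond `a₂` meet here. Their sum lies in Q, so the element falls back to the
    -- translate of 0, and the coefficients of the sum join `p` and `q`.
    step (suc (suc i)) (suc j , p , q , refl)
      with c , eq ← sums∈Q (suc (suc i)) (suc (suc j)) (s≤s (s≤s z≤n)) (s≤s (s≤s z≤n)) =
      zero , c zero + p , c (suc zero) + q ,
      trans (sym (+-assoc (a (suc (suc i))) _ _))
        (trans (cong (_+ (p * a₁ + q * a₂)) eq) (collect (c zero) (c (suc zero)) p q a₁ a₂))
      where
      collect : ∀ c d p q x y → c * x + (d * y + 0) + (p * x + q * y) ≡ (c + p) * x + (d + q) * y
      collect = solve-∀

  -- Adding `a₁` on the left avoids truncated subtraction, as the generator may be smaller than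
  -- `a₁`.
  OnProgression : Fin (1 + m) → Pred ℕ _
  OnProgression j x = ∃[ q ] x + a₁ ≡ moduleGenerators j + q * a₂

  pseudoFrobenius⇒onProgression : 0 < a₁ → (∀ {x} → S x → QSpan x) →
    ∀ {x} → PseudoFrobenius S x → ∃[ j ] OnProgression j x
  pseudoFrobenius⇒onProgression a₁>0 S⊆ {x} (x∉S , x+)
    with S⊆ (x+ a₁ (subst S (*-identityˡ a₁) (⟨⟩-multiple a zero 1)) a₁>0)
  ... | j , zero  , q , eq = j , q , eq
  -- One copy of `a₁` cancels from both sides, which exhibits `x` itself as an element of `S`.
  ... | j , suc p , q , eq = contradiction
    (QSpan⊆⟨⟩ (j , p , q , +-cancelʳ-≡ a₁ _ _ (trans eq (shift (moduleGenerators j) a₁ (p * a₁) (q * a₂))))) x∉S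
    where
    shift : ∀ x w y z → x + (w + y + z) ≡ x + (y + z) + w
    shift = solve-∀

  -- Here `y` equals `x + (r ∸ q) * a₂`, and the added term is a positive element of `S`.
  progression-< : 0 < a₂ → ∀ {g x y q r} → PseudoFrobenius S x → q < r →
                  x + a₁ ≡ g + q * a₂ → y + a₁ ≡ g + r * a₂ → S y
  progression-< a₂>0 {g} {x} {y} {q} {r} (_ , x+) q<r x≡ y≡ =
    subst S (+-cancelʳ-≡ a₁ _ _ x+ka₂+a₁≡y+a₁)
      (x+ (k * a₂) (⟨⟩-multiple a (suc zero) k) (*-mono-≤ (m<n⇒0<n∸m q<r) a₂>0))
    where
    open ≡-Reasoning
    k = r ∸ q
    swapʳ : ∀ x y z → x + y + z ≡ x + z + y
    swapʳ = solve-∀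
    x+ka₂+a₁≡y+a₁ : x + k * a₂ + a₁ ≡ y + a₁
    x+ka₂+a₁≡y+a₁ = begin
      x + k * a₂ + a₁       ≡⟨ swapʳ x (k * a₂) a₁ ⟩
      x + a₁ + k * a₂       ≡⟨ cong (_+ k * a₂) x≡ ⟩
      g + q * a₂ + k * a₂   ≡⟨ +-assoc g _ _ ⟩
      g + (q * a₂ + k * a₂) ≡⟨ cong (g +_) (*-distribʳ-+ a₂ q k) ⟨
      g + (q + k) * a₂      ≡⟨ cong (λ h → g + h * a₂) (m+[n∸m]≡n (<⇒≤ q<r)) ⟩
      g + r * a₂            ≡⟨ y≡ ⟨
      y + a₁                ∎

  progression-unique : 0 < a₂ → ∀ j {x y} → PseudoFrobenius S x → PseudoFrobenius S y →
                       OnProgression j x → OnProgression j y → x ≡ y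
  progression-unique a₂>0 j {x} {y} Px Py (q , x≡) (r , y≡) with <-cmp q r
  ... | tri< q<r _ _  = contradiction (progression-< a₂>0 Px q<r x≡ y≡) (proj₁ Py)
  ... | tri≈ _ refl _ = +-cancelʳ-≡ a₁ x y (trans x≡ (sym y≡))
  ... | tri> _ _ r<q  = contradiction (progression-< a₂>0 Py r<q y≡ x≡) (proj₁ Px)

theorem1 : (m : ℕ) → let n = 2 + m in
    (a : Vector ℕ n) →
    (∀ i → 0 < a i) →
    let a₁ = a zero
        a₂ = a (suc zero)
        S = ⟨ a ⟩
        Q = ⟨ a₁ ∷ a₂ ∷ [] ⟩
    in
    gcd a₁ a₂ ≡ 1 →
    (∀ (i j : Fin n) → 2 ≤ toℕ i → 2 ≤ toℕ j → Q (a i + a j)) →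
    Σ[ t ∈ ℕ ] HasType S t × t ≤ n ∸ 1
theorem1 m a pos gcd≡1 sums∈Q =
  length xs , (xs , xs-unique , (λ x → mk⇔ ∈⇒PF PF⇒∈) , refl) ,
  -- Each pseudo-Frobenius number is labelled by the module generator of a progression through it.
  -- There are `1 + m` labels, which is what `n ∸ 1` computes to.
  unique⇒length≤ xs-unique (proj₁ ∘ progression) λ x∈ y∈ eq →
    progression-unique a (pos (suc zero)) (proj₁ (progression y∈)) (∈⇒PF x∈) (∈⇒PF y∈)
      (subst (λ j → OnProgression a j _) eq (proj₂ (progression x∈)))
      (proj₂ (progression y∈))
  where
  S = ⟨ a ⟩
  bound = coprime⇒cofinite (a zero) (a (suc zero)) (pos zero) (pos (suc zero)) gcd≡1
  N = proj₁ bound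
  cofinite : ∀ z → N ≤ z → S z
  cofinite z N≤z = QSpan⊆⟨⟩ a (zero , proj₂ bound z N≤z)
  PF? : Decidable (PseudoFrobenius S)
  PF? = pseudoFrobenius? (⟨⟩? a pos) N cofinite
  -- From `N` on every number is in `S`, so no pseudo-Frobenius number is missed by stopping below
  -- `N`.
  xs = filter PF? (upTo N)
  xs-unique : Unique xs
  xs-unique = filter⁺ PF? (upTo⁺ N)
  ∈⇒PF : ∀ {x} → x ∈ xs → PseudoFrobenius S x
  ∈⇒PF x∈ = proj₂ (∈-filter⁻ PF? {xs = upTo N} x∈)
  PF⇒∈ : ∀ {x} → PseudoFrobenius S x → x ∈ xs
  PF⇒∈ {x} Px = ∈-filter⁺ PF? (∈-upTo⁺ (≰⇒> (proj₁ Px ∘ cofinite x))) Px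
  progression : ∀ {x} → x ∈ xs → ∃[ j ] OnProgression a j x
  progression x∈ = pseudoFrobenius⇒onProgression a (pos zero) (⟨⟩⊆QSpan a sums∈Q) (∈⇒PF x∈)
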